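{- Let $H=\prod_p p^{a_p}<H'=\prod_p p^{b_p}$ be consecutive highly composite numbers with $L_-(H,H')=2$. Put $g=\gcd(H,H')$, $C=H'/g$, $\delta=d(g)/d(H)$. Let the two required deletion layers have prime bases $r,s$ (possibly $r=s$), so $H/g=rs$, and old exponent levels $j_r,j_s$. Consider an admissible deletion order $r\mid s$, meaning that the $r$-layer is deleted first and the $s$-layer second, and put $\alpha_r=\frac{j_r}{j_r+1}$. Then the optimal normalised capacity $\beta_{r\mid s}$ among $H'$-admissible geodesics from $H$ to $H'$ with this deletion order is $$\beta_{r\mid s}=\min\{\alpha_r,\ \delta\,R_s(C;g)\},\qquad R_s(C;g):=\max_{\substack{Q\mid C\\ Q\le C/s}}\frac{d(gQ)}{d(g)}.$$ If the two deletions lie in distinct prime coordinates ($r\ne s$), both orders are admissible and $$\beta^{\mathrm{geo}}(H,H')=\max\{\beta_{r\mid s},\beta_{s\mid r}\}.$$ If both deletions occur in one coordinate ($r=s$), only the order deleting the top layer first is admissible.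
   Context: $d(n)$ denotes the number of positive divisors of $n$. A positive integer $H$ is highly composite if $d(m)<d(H)$ for all integers $1\le m<H$. Two highly composite numbers $H<H'$ are consecutive if no highly composite number lies strictly between them. Put $L_-(H,H')=\sum_p\max(a_p-b_p,0)$. An exponent-lattice geodesic from $H$ to $H'$ is a sequence of positive integers starting at $H$ and ending at $H'$ in which each step changes the exponent of exactly one prime by one unit, always in the direction of its target exponent; increasing steps are insertions, decreasing steps deletions. It is $H'$-admissible if every vertex $z$ satisfies $z\le H'$. The normalised capacity of a geodesic $\gamma$ is $\frac1{d(H)}\min_{z\in\gamma}d(z)$ (over all vertices, endpoints included), and $\beta^{\mathrm{geo}}(H,H')$ is the maximum of this quantity over all $H'$-admissible geodesics from $H$ to $H'$. A required deletion layer with prime base $p$ and old exponent level $j$ is the move lowering the exponent of $p$ from $j$ to $j-1$, where $b_p<j\le a_p$. Thus if $r\ne s$ then $j_r=a_r$, $j_s=a_s$; if $r=s$, the two levels are $a_r$ and $a_r-1$ and the first deleted layer has level $a_r$. A deletion order is admissible if within one prime coordinate the higher level is deleted before the lower one. The set over which the maximum in $R_s(C;g)$ is taken always contains $Q=1$. -}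

module Defs where

open import Data.Integer using (+_)
open import Data.List using (List; []; _∷_; length; filter; map; applyUpTo; upTo)
open import Data.List.Properties using (filter-some)
open import Data.List.Relation.Unary.All using (All)
open import Data.List.Relation.Unary.AllPairs using (AllPairs)
open import Data.List.Relation.Unary.Any using (here)
open import Data.Nat using (ℕ; zero; suc; _*_; _∸_; _^_; _⊓_; _≤_; _<_; NonZero; >-nonZero; ≢-nonZero; ≢-nonZero⁻¹)
open import Data.Nat.Divisibility using (_∣_; _∣?_; 1∣_)
open import Data.Nat.GCD using (gcd; gcd[m,n]≢0)
open import Data.Nat.ListAction using (sum)
open import Data.Nat.Primality using (Prime; prime?)
open import Data.Product using (Σ-syntax; _×_; _,_)
open import Data.Rational using (ℚ; _/_) renaming (_≤_ to _≤ℚ_)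
open import Data.Sum using (inj₁)
open import Relation.Binary.PropositionalEquality using (_≡_; _≢_)
open import Relation.Nullary using (¬_; yes; no)

d : ℕ → ℕ
d n = length (filter (_∣? n) (applyUpTo suc n))

d-nonZero : ∀ n .{{_ : NonZero n}} → NonZero (d n)
d-nonZero (suc n) = >-nonZero (filter-some (_∣? suc n) (here (1∣ suc n)))

gcd-nonZero : ∀ m n .{{_ : NonZero m}} → NonZero (gcd m n)
gcd-nonZero m n = ≢-nonZero (gcd[m,n]≢0 m n (inj₁ (≢-nonZero⁻¹ m)))

HighlyComposite : (n : ℕ) .{{_ : NonZero n}} → Set
HighlyComposite n = ∀ m → 1 ≤ m → m < n → d m < d n

record Consecutive (H H' : ℕ) .{{_ : NonZero H}} .{{_ : NonZero H'}} : Set where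
  field
    lower   : HighlyComposite H
    upper   : HighlyComposite H'
    ordered : H < H'
    nothing-between : ∀ m .{{_ : NonZero m}} → H < m → m < H' → ¬ HighlyComposite m

-- The largest e ≤ k with p ^ e ∣ n.
exponentUpTo : ℕ → ℕ → ℕ → ℕ
exponentUpTo zero    p n = 0
exponentUpTo (suc k) p n with (p ^ suc k) ∣? n
... | yes _ = suc k
... | no  _ = exponentUpTo k p n

-- The bound k = n loses nothing for p ≥ 2 and n ≥ 1, since then n < p ^ n.
exponent : ℕ → ℕ → ℕ
exponent p n = exponentUpTo n p n

-- Primes p > H have exponent 0 in H and contribute nothing; truncated
-- subtraction is max (a_p - b_p) 0.
L₋ : ℕ → ℕ → ℕ
L₋ H H' = sum (map (λ p → exponent p H ∸ exponent p H') (filter prime? (upTo (suc H))))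

record ExponentsAgreeExceptAt (p x y : ℕ) : Set where
  constructor agree
  field
    elsewhere : ∀ q → Prime q → q ≢ p → exponent q x ≡ exponent q y

-- A geodesic step x → y towards the target t.
data Step (t x y : ℕ) : Set where
  insertion : ∀ p → Prime p → 0 < y → ExponentsAgreeExceptAt p x y →
              exponent p x < exponent p t → exponent p y ≡ suc (exponent p x) → Step t x y
  deletion  : ∀ p → Prime p → 0 < y → ExponentsAgreeExceptAt p x y →
              exponent p t < exponent p x → exponent p x ≡ suc (exponent p y) → Step t x y

infixr 5 _∷_

-- Geodesic t x is the type of exponent-lattice geodesics from x to t.
data Geodesic (t : ℕ) : ℕ → Set where
  []  : Geodesic t t
  _∷_ : ∀ {x y} → Step t x y → Geodesic t y → Geodesic t x

vertices : ∀ {t x} → Geodesic t x → List ℕ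
vertices {t} []        = t ∷ []
vertices {x = x} (_ ∷ γ) = x ∷ vertices γ

Admissible : ∀ {t x} → Geodesic t x → Set
Admissible {t} γ = All (_≤ t) (vertices γ)

minDivisors : ∀ {t x} → Geodesic t x → ℕ
minDivisors {t} []        = d t
minDivisors {x = x} (_ ∷ γ) = d x ⊓ minDivisors γ

capacity : ∀ {t x} .{{_ : NonZero x}} → Geodesic t x → ℚ
capacity {x = x} γ = (+ minDivisors γ / d x) {{d-nonZero x}}

-- A pair (p , j): prime base p and old exponent level j.
Layer : Set
Layer = ℕ × ℕ

RequiredDeletion : ℕ → ℕ → Layer → Set
RequiredDeletion H H' (p , j) = Prime p × exponent p H' < j × j ≤ exponent p H

-- Earlier deletions come first in the list.
AdmissibleOrder : List Layer → Set
AdmissibleOrder = AllPairs λ { (p , j) (q , k) → p ≡ q → k < j }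

deletionOrder : ∀ {t x} → Geodesic t x → List Layer
deletionOrder [] = []
deletionOrder (insertion _ _ _ _ _ _ ∷ γ) = deletionOrder γ
deletionOrder {x = x} (deletion p _ _ _ _ _ ∷ γ) = (p , exponent p x) ∷ deletionOrder γ

IsMaximum : (ℚ → Set) → ℚ → Set
IsMaximum S m = S m × (∀ x → S x → x ≤ℚ m)

Isβgeo : (H H' : ℕ) .{{_ : NonZero H}} → ℚ → Set
Isβgeo H H' = IsMaximum λ c → Σ[ γ ∈ Geodesic H' H ] Admissible γ × c ≡ capacity γ

-- The optimal capacity among geodesics with a prescribed deletion order.
Isβ : (H H' : ℕ) .{{_ : NonZero H}} → List Layer → ℚ → Set
Isβ H H' σ = IsMaximum λ c →
  Σ[ γ ∈ Geodesic H' H ] Admissible γ × deletionOrder γ ≡ σ × c ≡ capacity γ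

-- R_s(C;g); the condition Q * s ≤ C is Q ≤ C / s without rounding.
IsR : (s C g : ℕ) .{{_ : NonZero g}} → ℚ → Set
IsR s C g = IsMaximum λ c → Σ[ Q ∈ ℕ ] Q ∣ C × Q * s ≤ C × c ≡ (+ d (g * Q) / d g) {{d-nonZero g}}

α : ℕ → ℚ
α j = + j / suc j

δ : (H H' : ℕ) .{{_ : NonZero H}} → ℚ
δ H H' = (+ d (gcd H H') / d H) {{d-nonZero H}}

{-# OPTIONS --safe #-}
-- Since H and H' are consecutive, no m strictly between them has d m > d H: the least such m would
-- be highly composite.  Hence an admissible geodesic cannot start with an insertion, which would
-- reach a proper multiple of H below H'.  So the first step deletes r, at capacity
-- d (H / r) / d H = α_r.  The vertex reached by the second deletion is g * Q for some Q ∣ C, and its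
-- predecessor g * Q * s must be at most H' = g * C, i.e. Q ≤ C / s; this gives the upper bound.
-- Conversely, deleting r, inserting an optimal Q, deleting s and inserting C / Q attains it, because
-- d only increases along insertions.
module Submission where

open import Defs
import Data.Integer as ℤ
import Data.Integer.Properties as ℤ
open import Data.List using (List; []; _∷_; _++_; map; filter; applyUpTo; upTo)
open import Data.List.Membership.Propositional using (_∈_)
open import Data.List.Membership.Propositional.Properties using (∈-applyUpTo⁺; ∈-upTo⁺; ∈-filter⁺; ∈-filter⁻; ∈-map⁺; ∈-map⁻; ∈-++⁺ˡ; ∈-++⁺ʳ; ∈-++⁻)
open import Data.List.Membership.Propositional.Properties.WithK using (unique∧set⇒bag)
open import Data.List.Properties using (length-++; length-map; ∷-injective)
open import Data.List.Relation.Binary.BagAndSetEquality using (∼bag⇒↭)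
open import Data.List.Relation.Binary.Permutation.Propositional.Properties using (↭-length)
open import Data.List.Relation.Unary.All using (All; []; _∷_)
open import Data.List.Relation.Unary.AllPairs using ([]; _∷_)
open import Data.List.Relation.Unary.Any using (here; there)
open import Data.List.Relation.Unary.Unique.Propositional using (Unique)
import Data.List.Relation.Unary.Unique.Propositional.Properties as Unique
open import Data.Nat
open import Data.Nat.Divisibility
open import Data.Nat.DivMod using (m/n*n≡m; m*n/n≡m; /-congˡ)
open import Data.Nat.GCD using (gcd; gcd-greatest; gcd[m,n]∣m; gcd[m,n]∣n)
open import Data.Nat.Induction using (<-rec)
open import Data.Nat.ListAction using (sum; product)
open import Data.Nat.Primality using (Prime; prime?; prime⇒nonZero; prime⇒nonTrivial; prime⇒irreducible; euclidsLemma; ¬prime[1])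
open import Data.Nat.Primality.Factorisation using (PrimeFactorisation; factorise)
open import Data.Nat.Properties
open import Data.Product using (Σ-syntax; ∃-syntax; _×_; _,_; proj₁; proj₂)
import Data.Rational as ℚ
import Data.Rational.Properties as ℚ
import Data.Rational.Unnormalised as ℚᵘ
import Data.Rational.Unnormalised.Properties as ℚᵘ
open import Data.Sum using (_⊎_; inj₁; inj₂; [_,_]′)
open import Function using (_∘_; mk⇔)
open import Relation.Binary.Definitions using (tri<; tri≈; tri>)
open import Relation.Binary.PropositionalEquality
open import Relation.Nullary using (¬_; yes; no; contradiction; _×-dec_)
open import Relation.Unary using (Decidable)

-- Positivity and primes

*-pos : ∀ {m n} → 0 < m → 0 < n → 0 < m * n
*-pos {suc m} {suc n} _ _ = z<s

prime-pos : ∀ {p} → Prime p → 0 < p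
prime-pos pr = >-nonZero⁻¹ _ {{prime⇒nonZero pr}}

prime>1 : ∀ {p} → Prime p → 1 < p
prime>1 pr = nonTrivial⇒n>1 _ {{prime⇒nonTrivial pr}}

prime∣prime⇒≡ : ∀ {p q} → Prime p → Prime q → q ∣ p → q ≡ p
prime∣prime⇒≡ pp pq q∣p with prime⇒irreducible pp q∣p
... | inj₁ refl = contradiction pq ¬prime[1]
... | inj₂ q≡p  = q≡p

-- Exponents

^-monoʳ-∣ : ∀ p {m n} → m ≤ n → p ^ m ∣ p ^ n
^-monoʳ-∣ p {m} {n} m≤n = subst (p ^ m ∣_)
  (trans (sym (^-distribˡ-+-* p m (n ∸ m))) (cong (p ^_) (m+[n∸m]≡n m≤n)))
  (m∣m*n (p ^ (n ∸ m)))

n<p^n : ∀ {p} → 1 < p → ∀ n → n < p ^ n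
n<p^n 1<p zero    = z<s
n<p^n 1<p (suc n) = ≤-<-trans (n<p^n 1<p n) (^-monoʳ-< _ 1<p (n<1+n n))

^∣⇒≤exponentUpTo : ∀ k p n {e} → e ≤ k → p ^ e ∣ n → e ≤ exponentUpTo k p n
^∣⇒≤exponentUpTo zero    p n e≤k _ = e≤k
^∣⇒≤exponentUpTo (suc k) p n e≤k p^e∣n with (p ^ suc k) ∣? n
... | yes _ = e≤k
... | no ∤n with m≤n⇒m<n∨m≡n e≤k
...   | inj₁ e<1+k = ^∣⇒≤exponentUpTo k p n (s≤s⁻¹ e<1+k) p^e∣n
...   | inj₂ refl  = contradiction p^e∣n ∤n

^exponentUpTo∣ : ∀ k p n → p ^ exponentUpTo k p n ∣ n
^exponentUpTo∣ zero    p n = 1∣ n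
^exponentUpTo∣ (suc k) p n with (p ^ suc k) ∣? n
... | yes ∣n = ∣n
... | no  _  = ^exponentUpTo∣ k p n

-- The search bound `n` is large enough because `e < p ^ e ≤ n`. Together with `≤exponent⇒^∣` this
-- characterises exponents by divisibility, which is how later proofs handle them.
^∣⇒≤exponent : ∀ {p n e} → Prime p → 0 < n → p ^ e ∣ n → e ≤ exponent p n
^∣⇒≤exponent {p} {n} {e} pr n>0 p^e∣n = ^∣⇒≤exponentUpTo n p n
  (<⇒≤ (<-≤-trans (n<p^n (prime>1 pr) e) (∣⇒≤ {{>-nonZero n>0}} p^e∣n))) p^e∣n

≤exponent⇒^∣ : ∀ p n {e} → e ≤ exponent p n → p ^ e ∣ n
≤exponent⇒^∣ p n e≤ = ∣-trans (^-monoʳ-∣ p e≤) (^exponentUpTo∣ n p n)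

exponent>0⇒∣ : ∀ p n → 0 < exponent p n → p ∣ n
exponent>0⇒∣ p n e>0 = subst (_∣ n) (*-identityʳ p) (≤exponent⇒^∣ p n e>0)

∣⇒exponent≤ : ∀ {q m n} → Prime q → 0 < n → m ∣ n → exponent q m ≤ exponent q n
∣⇒exponent≤ {q} {m} pr n>0 m∣n =
  ^∣⇒≤exponent pr n>0 (∣-trans (≤exponent⇒^∣ q m ≤-refl) m∣n)

exponent-*-self : ∀ {p n} → Prime p → 0 < n → exponent p (p * n) ≡ suc (exponent p n)
exponent-*-self {p} {n} pr n>0 = ≤-antisym upper lower
  where
  instance _ = prime⇒nonZero pr
  lower : suc (exponent p n) ≤ exponent p (p * n)
  lower = ^∣⇒≤exponent pr (*-pos (prime-pos pr) n>0) (*-monoʳ-∣ p (≤exponent⇒^∣ p n ≤-refl))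
  upper : exponent p (p * n) ≤ suc (exponent p n)
  upper with exponent p (p * n) in eq
  ... | zero  = z≤n
  ... | suc e = s≤s (^∣⇒≤exponent pr n>0
                  (*-cancelˡ-∣ p (≤exponent⇒^∣ p (p * n) (≤-reflexive (sym eq)))))

-- Euclid's lemma peels the factors `q` off `n` one at a time, since none of them can come from `m`.
^∣-cancel-∤ : ∀ {q m} → Prime q → ¬ q ∣ m → ∀ e {n} → q ^ e ∣ m * n → q ^ e ∣ n
^∣-cancel-∤ pr q∤m zero {n} _ = 1∣ n
^∣-cancel-∤ {q} {m} pr q∤m (suc e) {n} q^∣mn with euclidsLemma m n pr (m*n∣⇒m∣ q (q ^ e) q^∣mn)
... | inj₁ q∣m = contradiction q∣m q∤m
... | inj₂ (divides k refl) = subst (q * q ^ e ∣_) (*-comm q k)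
        (*-monoʳ-∣ q (^∣-cancel-∤ pr q∤m e (*-cancelˡ-∣ q {{prime⇒nonZero pr}}
          (subst (q * q ^ e ∣_) rearrange q^∣mn))))
  where
  rearrange : m * (k * q) ≡ q * (m * k)
  rearrange = trans (sym (*-assoc m k q)) (*-comm (m * k) q)

exponent-*-∤ : ∀ {q m n} → Prime q → 0 < m → 0 < n → ¬ q ∣ m → exponent q (m * n) ≡ exponent q n
exponent-*-∤ {q} {m} {n} pr m>0 n>0 q∤m = ≤-antisym
  (^∣⇒≤exponent pr n>0 (^∣-cancel-∤ pr q∤m (exponent q (m * n)) (≤exponent⇒^∣ q (m * n) ≤-refl)))
  (∣⇒exponent≤ pr (*-pos m>0 n>0) (n∣m*n m))

exponent-*-≢ : ∀ {p q n} → Prime p → Prime q → q ≢ p → 0 < n → exponent q (p * n) ≡ exponent q n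
exponent-*-≢ pp pq q≢p n>0 =
  exponent-*-∤ pq (prime-pos pp) n>0 (q≢p ∘ prime∣prime⇒≡ pp pq)

-- Existence of a prime factorisation, turned into an induction principle. It serves for
-- divisibility, for the growth of `d`, and for paths of insertions.
prime-induction : (P : ℕ → Set) → P 1 → (∀ p n → Prime p → 0 < n → P n → P (p * n)) →
                  ∀ n → 0 < n → P n
prime-induction P P1 P* n n>0 =
  subst P (sym isFactorisation) (proj₂ (go factors factorsPrime))
  where
  open PrimeFactorisation (factorise n {{>-nonZero n>0}})
  go : ∀ ps → All Prime ps → 0 < product ps × P (product ps)
  go []       []         = z<s , P1
  go (p ∷ ps) (pr ∷ prs) with go ps prs
  ... | >0 , Pps = *-pos (prime-pos pr) >0 , P* p (product ps) pr >0 Pps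

-- Induction on the prime factors of `x`. The motive quantifies over `y` because each step cancels a
-- prime from both `x` and `y`.
exponents≤⇒∣ : ∀ {x y} → 0 < x → 0 < y → (∀ q → Prime q → exponent q x ≤ exponent q y) → x ∣ y
exponents≤⇒∣ {x} x>0 y>0 = prime-induction Goal (λ y _ _ → 1∣ y) step x x>0 _ y>0
  where
  Goal : ℕ → Set
  Goal x = ∀ y → 0 < y → (∀ q → Prime q → exponent q x ≤ exponent q y) → x ∣ y
  step : ∀ p n → Prime p → 0 < n → Goal n → Goal (p * n)
  step p n pp n>0 ih y y>0 le
    with exponent>0⇒∣ p y (<-≤-trans (subst (0 <_) (sym (exponent-*-self pp n>0)) z<s) (le p pp))
  ... | divides zero    refl = contradiction y>0 (n≮n 0)
  ... | divides k@(suc _) refl = subst (p * n ∣_) (*-comm p k) (*-monoʳ-∣ p (ih k z<s le′))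
    where
    le′ : ∀ q → Prime q → exponent q n ≤ exponent q k
    le′ q pq with q ≟ p
    ... | yes refl = s≤s⁻¹ (subst₂ _≤_ (exponent-*-self pp n>0)
                       (trans (cong (exponent p) (*-comm k p)) (exponent-*-self pp z<s)) (le p pp))
    ... | no q≢p   = subst₂ _≤_ (exponent-*-≢ pp pq q≢p n>0)
                       (trans (cong (exponent q) (*-comm k p)) (exponent-*-≢ pp pq q≢p z<s)) (le q pq)

exponents≡⇒≡ : ∀ {x y} → 0 < x → 0 < y → (∀ q → Prime q → exponent q x ≡ exponent q y) → x ≡ y
exponents≡⇒≡ x>0 y>0 eq = ∣-antisym
  (exponents≤⇒∣ x>0 y>0 λ q pq → ≤-reflexive (eq q pq))
  (exponents≤⇒∣ y>0 x>0 λ q pq → ≤-reflexive (sym (eq q pq)))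

-- The divisor function

divisors : ℕ → List ℕ
divisors n = filter (_∣? n) (applyUpTo suc n)

∈-divisors⁺ : ∀ {e n} → 0 < n → e ∣ n → e ∈ divisors n
∈-divisors⁺ {zero}  n>0 e∣n = contradiction (subst (0 <_) (0∣⇒≡0 e∣n) n>0) (n≮n 0)
∈-divisors⁺ {suc e} n>0 e∣n =
  ∈-filter⁺ (_∣? _) (∈-applyUpTo⁺ suc (∣⇒≤ {{>-nonZero n>0}} e∣n)) e∣n

∈-divisors⁻ : ∀ {e n} → e ∈ divisors n → e ∣ n
∈-divisors⁻ {n = n} = proj₂ ∘ ∈-filter⁻ (_∣? n) {xs = applyUpTo suc n}

divisors-unique : ∀ n → Unique (divisors n)
divisors-unique n = Unique.filter⁺ (_∣? n)
  (Unique.applyUpTo⁺₁ suc n λ i<j _ → <⇒≢ (s<s i<j))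

d-pos : ∀ {n} → 0 < n → 0 < d n
d-pos {n} n>0 = >-nonZero⁻¹ _ {{d-nonZero n {{>-nonZero n>0}}}}

-- The divisors of p ^ suc k * m that do not divide p ^ k * m are the p ^ suc k * f with f ∣ m.
d-^suc-* : ∀ {p m} → Prime p → 0 < m → ¬ p ∣ m → ∀ k → d (p ^ suc k * m) ≡ d (p ^ k * m) + d m
-- Two duplicate-free lists with the same members are permutations of each other, hence equally
-- long.
d-^suc-* {p} {m} pr m>0 p∤m k = trans (↭-length (∼bag⇒↭ (unique∧set⇒bag
    (divisors-unique N) unique-new (mk⇔ to from))))
  (trans (length-++ (divisors (p ^ k * m))) (cong (d (p ^ k * m) +_) (length-map (p ^ suc k *_) (divisors m))))
  where
  instance
    _ = prime⇒nonZero pr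
    p^≢0 = m^n≢0 p (suc k)
  N = p ^ suc k * m
  p^k>0 : ∀ j → 0 < p ^ j
  p^k>0 j = m^n>0 p j
  N>0 : ∀ j → 0 < p ^ j * m
  N>0 j = *-pos (p^k>0 j) m>0
  new = map (p ^ suc k *_) (divisors m)
  N≡ : N ≡ p * (p ^ k * m)
  N≡ = *-assoc p (p ^ k) m

  exponent-p : ∀ j → exponent p (p ^ j * m) ≡ j
  exponent-p zero = trans (cong (exponent p) (*-identityˡ m)) (n≤0⇒n≡0 (≮⇒≥ (p∤m ∘ exponent>0⇒∣ p m)))
  exponent-p (suc j) = trans (cong (exponent p) (*-assoc p (p ^ j) m))
    (trans (exponent-*-self pr (N>0 j)) (cong suc (exponent-p j)))

  old-∌-p^ : ∀ {e} → e ∣ p ^ k * m → ¬ p ^ suc k ∣ e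
  old-∌-p^ e∣ p^∣e = 1+n≰n (subst (suc k ≤_) (exponent-p k) (^∣⇒≤exponent pr (N>0 k) (∣-trans p^∣e e∣)))

  unique-new : Unique (divisors (p ^ k * m) ++ new)
  unique-new = Unique.++⁺ (divisors-unique (p ^ k * m))
    (Unique.map⁺ (*-cancelˡ-≡ _ _ (p ^ suc k)) (divisors-unique m)) disjoint
    where
    disjoint : ∀ {e} → ¬ (e ∈ divisors (p ^ k * m) × e ∈ new)
    disjoint (old , e∈new) with ∈-map⁻ (p ^ suc k *_) e∈new
    ... | f , _ , refl = old-∌-p^ (∈-divisors⁻ old) (m∣m*n f)

  to : ∀ {e} → e ∈ divisors N → e ∈ divisors (p ^ k * m) ++ new
  to {e} e∈ with (p ^ suc k) ∣? e
  ... | yes (divides f refl) = ∈-++⁺ʳ _ (subst (_∈ new) (*-comm (p ^ suc k) f)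
          (∈-map⁺ (p ^ suc k *_) (∈-divisors⁺ m>0
            (*-cancelˡ-∣ (p ^ suc k) (subst (_∣ N) (*-comm f (p ^ suc k)) (∈-divisors⁻ e∈))))))
  ... | no p^∤e = ∈-++⁺ˡ (∈-divisors⁺ (N>0 k) (exponents≤⇒∣ e>0 (N>0 k) le))
    where
    e∣N = ∈-divisors⁻ {e} {N} e∈
    e>0 : 0 < e
    e>0 = n≢0⇒n>0 λ { refl → <⇒≢ (N>0 (suc k)) (sym (0∣⇒≡0 e∣N)) }
    le : ∀ q → Prime q → exponent q e ≤ exponent q (p ^ k * m)
    le q pq with q ≟ p
    ... | yes refl = subst (exponent p e ≤_) (sym (exponent-p k))
                       (s≤s⁻¹ (≰⇒> (p^∤e ∘ ≤exponent⇒^∣ p e)))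
    ... | no q≢p   = subst (exponent q e ≤_)
                       (trans (cong (exponent q) N≡) (exponent-*-≢ pr pq q≢p (N>0 k)))
                       (∣⇒exponent≤ pq (N>0 (suc k)) e∣N)

  from : ∀ {e} → e ∈ divisors (p ^ k * m) ++ new → e ∈ divisors N
  from {e} e∈ with ∈-++⁻ (divisors (p ^ k * m)) e∈
  ... | inj₁ old = ∈-divisors⁺ (N>0 (suc k))
          (∣-trans (∈-divisors⁻ old) (subst (p ^ k * m ∣_) (sym N≡) (n∣m*n p)))
  ... | inj₂ e∈new with ∈-map⁻ (p ^ suc k *_) e∈new
  ...   | f , f∈ , refl = ∈-divisors⁺ (N>0 (suc k)) (*-monoʳ-∣ (p ^ suc k) (∈-divisors⁻ f∈))

d-^-* : ∀ {p m} → Prime p → 0 < m → ¬ p ∣ m → ∀ k → d (p ^ k * m) ≡ suc k * d m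
d-^-* {m = m} pr m>0 p∤m zero    = trans (cong d (*-identityˡ m)) (sym (*-identityˡ (d m)))
d-^-* {m = m} pr m>0 p∤m (suc k) =
  trans (d-^suc-* pr m>0 p∤m k) (trans (+-comm _ (d m)) (cong (d m +_) (d-^-* pr m>0 p∤m k)))

prime-part : ∀ p {n} → Prime p → 0 < n →
  ∃[ m ] 0 < m × (¬ p ∣ m) × n ≡ p ^ exponent p n * m
prime-part p {n} pr n>0 with ≤exponent⇒^∣ p n ≤-refl
... | divides m n≡ = m , m>0 , p∤m , n≡′
  where
  n≡′ : n ≡ p ^ exponent p n * m
  n≡′ = trans n≡ (*-comm m _)
  m>0 : 0 < m
  m>0 = n≢0⇒n>0 λ { refl → <⇒≢ n>0 (sym n≡) }
  p∤m : ¬ p ∣ m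
  p∤m p∣m = 1+n≰n (^∣⇒≤exponent pr n>0 (subst (p ^ suc (exponent p n) ∣_) (sym n≡) (*-pres-∣ p∣m ∣-refl)))

-- Cross-multiplied form of `d n / d (p * n) = (k + 1) / (k + 2)`, where `k` is the exponent of `p`
-- in `n`. For `n = H / r` this ratio is `α` of the deleted level.
d-prime-* : ∀ {p n} → Prime p → 0 < n →
  d n * suc (suc (exponent p n)) ≡ suc (exponent p n) * d (p * n)
d-prime-* {p} {n} pr n>0 with prime-part p pr n>0
... | m , m>0 , p∤m , n≡ = begin
  d n * suc (suc k)               ≡⟨ cong (_* suc (suc k)) (trans (cong d n≡) (d-^-* pr m>0 p∤m k)) ⟩
  suc k * d m * suc (suc k)       ≡⟨ *-assoc (suc k) (d m) _ ⟩
  suc k * (d m * suc (suc k))     ≡⟨ cong (suc k *_) (*-comm (d m) _) ⟩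
  suc k * (suc (suc k) * d m)     ≡⟨ cong (suc k *_) (d-^-* pr m>0 p∤m (suc k)) ⟨
  suc k * d (p ^ suc k * m)       ≡⟨ cong (λ x → suc k * d x) (*-assoc p (p ^ k) m) ⟩
  suc k * d (p * (p ^ k * m))     ≡⟨ cong (λ x → suc k * d (p * x)) n≡ ⟨
  suc k * d (p * n)               ∎
  where
  open ≡-Reasoning
  k = exponent p n

d-<-prime-* : ∀ {p n} → Prime p → 0 < n → d n < d (p * n)
d-<-prime-* {p} {n} pr n>0 = *-cancelˡ-< k (d n) (d (p * n)) (begin-strict
  k * d n        ≡⟨ *-comm k (d n) ⟩
  d n * k        <⟨ *-monoʳ-< (d n) {{>-nonZero (d-pos n>0)}} (n<1+n k) ⟩
  d n * suc k    ≡⟨ d-prime-* pr n>0 ⟩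
  k * d (p * n)  ∎)
  where
  open ≤-Reasoning
  k = suc (exponent p n)

d-mono-* : ∀ {Q} → 0 < Q → ∀ {x} → 0 < x → d x ≤ d (Q * x)
d-mono-* {Q} Q>0 {x} x>0 = prime-induction (λ Q → d x ≤ d (Q * x))
  (≤-reflexive (cong d (sym (*-identityˡ x))))
  (λ p n pr n>0 ih → ≤-trans ih (<⇒≤ (subst (λ y → d (n * x) < d y) (sym (*-assoc p n x))
     (d-<-prime-* pr (*-pos n>0 x>0)))))
  Q Q>0

-- The least m > H with d m > d H would be highly composite.
consecutive⇒d≤ : ∀ {H H'} .{{_ : NonZero H}} .{{_ : NonZero H'}} → Consecutive H H' →
  ∀ m → H < m → m < H' → d m ≤ d H
consecutive⇒d≤ {H} {H'} cons = <-rec (λ m → H < m → m < H' → d m ≤ d H) bound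
  where
  open Consecutive cons
  bound : ∀ m → (∀ {k} → k < m → H < k → k < H' → d k ≤ d H) → H < m → m < H' → d m ≤ d H
  bound m ih H<m m<H' = ≮⇒≥ λ dH<dm →
    let highly : ∀ k → 1 ≤ k → k < m → d k < d m
        highly k k>0 k<m = ≤-<-trans (below k k>0 k<m) dH<dm
    in nothing-between m {{>-nonZero (≤-<-trans z≤n H<m)}} H<m m<H' highly
    where
    -- Numbers above `H` are covered by the induction hypothesis, numbers below it by the high
    -- compositeness of `H`; so `d m > d H` would make `m` highly composite.
    below : ∀ k → 1 ≤ k → k < m → d k ≤ d H
    below k k>0 k<m with <-≤-connex H k
    ... | inj₁ H<k = ih k<m H<k (<-trans k<m m<H')
    ... | inj₂ k≤H with m≤n⇒m<n∨m≡n k≤H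
    ...   | inj₁ k<H  = <⇒≤ (lower k k>0 k<H)
    ...   | inj₂ refl = ≤-refl

-- Geodesics

-- A step only constrains exponents; unique factorisation recovers the multiplication by `p`.
-- Positivity matters because `0` has the same prime exponents as `1`. Deletions use this with the
-- endpoints exchanged.
prime-multiple : ∀ {p x y} → Prime p → 0 < x → 0 < y → ExponentsAgreeExceptAt p x y →
  exponent p y ≡ suc (exponent p x) → y ≡ p * x
prime-multiple {p} {x} {y} pr x>0 y>0 (agree elsewhere) at-p =
  exponents≡⇒≡ y>0 (*-pos (prime-pos pr) x>0) eq
  where
  eq : ∀ q → Prime q → exponent q y ≡ exponent q (p * x)
  eq q pq with q ≟ p
  ... | yes refl = trans at-p (sym (exponent-*-self pr x>0))
  ... | no q≢p   = trans (sym (elsewhere q pq q≢p)) (sym (exponent-*-≢ pr pq q≢p x>0))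

agree-sym : ∀ {p x y} → ExponentsAgreeExceptAt p x y → ExponentsAgreeExceptAt p y x
agree-sym (agree elsewhere) = agree λ q pq q≢p → sym (elsewhere q pq q≢p)

insertion-step : ∀ {t p x} → Prime p → 0 < x → exponent p x < exponent p t → Step t x (p * x)
insertion-step {p = p} pr x>0 lt = insertion p pr (*-pos (prime-pos pr) x>0)
  (agree λ q pq q≢p → sym (exponent-*-≢ pr pq q≢p x>0)) lt (exponent-*-self pr x>0)

start≤ : ∀ {t x} (γ : Geodesic t x) → Admissible γ → x ≤ t
start≤ []      (x≤t ∷ _) = x≤t
start≤ (_ ∷ _) (x≤t ∷ _) = x≤t

minDivisors≤ : ∀ {t x} (γ : Geodesic t x) → minDivisors γ ≤ d x
minDivisors≤ []      = ≤-refl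
minDivisors≤ (_ ∷ γ) = m⊓n≤m _ (minDivisors γ)

insertions-only⇒∣ : ∀ {t x} (γ : Geodesic t x) → 0 < x → deletionOrder γ ≡ [] → x ∣ t
insertions-only⇒∣ [] _ _ = ∣-refl
insertions-only⇒∣ (insertion p pr y>0 ag _ at-p ∷ γ) x>0 none =
  ∣-trans (subst (_ ∣_) (sym (prime-multiple pr x>0 y>0 ag at-p)) (n∣m*n p))
          (insertions-only⇒∣ γ y>0 none)

-- A deletion only happens while the exponent of `p` exceeds that in `t`, so afterwards it is still
-- at least that in `t`, hence at least that in `g`.
deletion-preserves-∣ : ∀ {t p y g} → Prime p → 0 < t → 0 < y → g ∣ t → g ∣ p * y →
  exponent p t < exponent p (p * y) → g ∣ y
deletion-preserves-∣ {t} {p} {y} {g} pr t>0 y>0 g∣t g∣py lt = exponents≤⇒∣ g>0 y>0 le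
  where
  g>0 : 0 < g
  g>0 = n≢0⇒n>0 λ { refl → <⇒≢ t>0 (sym (0∣⇒≡0 g∣t)) }
  le : ∀ q → Prime q → exponent q g ≤ exponent q y
  le q pq with q ≟ p
  ... | yes refl = ≤-trans (∣⇒exponent≤ pq t>0 g∣t)
                     (s≤s⁻¹ (subst (exponent p t <_) (exponent-*-self pr y>0) lt))
  ... | no q≢p   = subst (exponent q g ≤_) (exponent-*-≢ pr pq q≢p y>0)
                     (∣⇒exponent≤ pq (*-pos (prime-pos pr) y>0) g∣py)

-- The witness `z` is the vertex just after the deletion. Its predecessor `s * z` is a vertex, hence
-- at most `t`, and since only insertions follow, `z` divides `t`.
after-last-deletion : ∀ {t x g s j} (γ : Geodesic t x) → 0 < t → 0 < x → g ∣ t → g ∣ x →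
  Admissible γ → deletionOrder γ ≡ (s , j) ∷ [] →
  ∃[ z ] g ∣ z × z ∣ t × s * z ≤ t × minDivisors γ ≤ d z
after-last-deletion {x = x} (insertion p pr y>0 ag _ at-p ∷ γ) t>0 x>0 g∣t g∣x (_ ∷ adm) order
  with after-last-deletion γ t>0 y>0 g∣t
         (∣-trans g∣x (subst (x ∣_) (sym (prime-multiple pr x>0 y>0 ag at-p)) (n∣m*n p))) adm order
... | z , g∣z , z∣t , sz≤t , min≤ = z , g∣z , z∣t , sz≤t , ≤-trans (m⊓n≤n (d x) (minDivisors γ)) min≤
after-last-deletion {t} {x} (_∷_ {y = y} (deletion p pr y>0 ag lt at-p) γ) t>0 x>0 g∣t g∣x (x≤t ∷ adm) order
  with ∷-injective order
... | refl , rest = y , deletion-preserves-∣ pr t>0 y>0 g∣t (subst (_ ∣_) x≡ g∣x)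
                          (subst (λ w → exponent p t < exponent p w) x≡ lt)
                      , insertions-only⇒∣ γ y>0 rest
                      , subst (_≤ t) x≡ x≤t
                      , ≤-trans (m⊓n≤n (d x) (minDivisors γ)) (minDivisors≤ γ)
  where
  x≡ : x ≡ p * y
  x≡ = prime-multiple pr y>0 x>0 (agree-sym ag) at-p

-- An initial insertion would reach a vertex strictly between x and t with more divisors than x.
first-deletion : ∀ {t x g r s jr js} (γ : Geodesic t x) → 0 < t → 0 < x → ¬ x ∣ t →
  (∀ m → x < m → m < t → d m ≤ d x) → g ∣ t → g ∣ x →
  Admissible γ → deletionOrder γ ≡ (r , jr) ∷ (s , js) ∷ [] →
  ∃[ y ] ∃[ z ] x ≡ r * y × minDivisors γ ≤ d y
              × g ∣ z × z ∣ t × s * z ≤ t × minDivisors γ ≤ d z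
first-deletion {t} {x} (_∷_ {y = y} (insertion p pr y>0 ag _ at-p) γ) t>0 x>0 x∤t gap g∣t g∣x (_ ∷ adm) order
  = contradiction (gap y x<y y<t) (<⇒≱ dx<dy)
  where
  y≡ : y ≡ p * x
  y≡ = prime-multiple pr x>0 y>0 ag at-p
  x<y : x < y
  x<y = subst (x <_) (trans (*-comm x p) (sym y≡)) (m<m*n x p {{>-nonZero x>0}} (prime>1 pr))
  dx<dy : d x < d y
  dx<dy = subst (λ w → d x < d w) (sym y≡) (d-<-prime-* pr x>0)
  -- Admissibility gives `y ≤ t`; equality would make `x` a divisor of `t`.
  y<t : y < t
  y<t = ≤∧≢⇒< (start≤ γ adm) λ y≡t → x∤t (subst (x ∣_) (trans (sym y≡) y≡t) (n∣m*n p))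
first-deletion {t} {x} (_∷_ {y = y} (deletion p pr y>0 ag lt at-p) γ) t>0 x>0 _ _ g∣t g∣x (x≤t ∷ adm) order
  with ∷-injective order
... | refl , rest =
  let x≡ = prime-multiple pr y>0 x>0 (agree-sym ag) at-p
      z , g∣z , z∣t , sz≤t , min≤ = after-last-deletion γ t>0 y>0 g∣t
        (deletion-preserves-∣ pr t>0 y>0 g∣t (subst (_ ∣_) x≡ g∣x)
          (subst (λ w → exponent p t < exponent p w) x≡ lt)) adm rest
      tail≤ = m⊓n≤n (d x) (minDivisors γ)
  in y , z , x≡ , ≤-trans tail≤ (minDivisors≤ γ) , g∣z , z∣t , sz≤t , ≤-trans tail≤ min≤

-- The prime factors of `Q` are inserted one by one. Each vertex passed divides `z ≤ t`, which gives
-- admissibility; the exponent condition on `z` keeps every insertion directed towards `t`; and `d`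
-- grows along insertions, so the bound `k` need only hold at `x` and on `γ`.
prepend-insertions : ∀ {t k} → ∀ Q → 0 < Q → ∀ {x z} → 0 < x → z ≡ Q * x → (γ : Geodesic t z) →
  (∀ q → Prime q → q ∣ Q → exponent q z ≤ exponent q t) →
  Admissible γ → k ≤ d x → k ≤ minDivisors γ →
  Σ[ γ′ ∈ Geodesic t x ] Admissible γ′ × deletionOrder γ′ ≡ deletionOrder γ × k ≤ minDivisors γ′
prepend-insertions {t} {k} = prime-induction Goal base step
  where
  Goal : ℕ → Set
  Goal Q = ∀ {x z} → 0 < x → z ≡ Q * x → (γ : Geodesic t z) →
    (∀ q → Prime q → q ∣ Q → exponent q z ≤ exponent q t) →
    Admissible γ → k ≤ d x → k ≤ minDivisors γ →
    Σ[ γ′ ∈ Geodesic t x ] Admissible γ′ × deletionOrder γ′ ≡ deletionOrder γ × k ≤ minDivisors γ′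
  base : Goal 1
  base {x} _ z≡ γ _ adm _ k≤ with trans z≡ (*-identityˡ x)
  ... | refl = γ , adm , refl , k≤
  step : ∀ p n → Prime p → 0 < n → Goal n → Goal (p * n)
  step p n pr n>0 ih {x} {z} x>0 z≡ γ le adm k≤dx k≤ =
    let γ′ , adm′ , order , k≤′ = ih px>0 z≡′ γ (λ q pq → le q pq ∘ ∣n⇒∣m*n p) adm
                                     (≤-trans k≤dx (<⇒≤ (d-<-prime-* pr x>0))) k≤
    in insertion-step pr x>0 lt ∷ γ′ , x≤t ∷ adm′ , order , ⊓-glb k≤dx k≤′
    where
    px>0 : 0 < p * x
    px>0 = *-pos (prime-pos pr) x>0
    z≡′ : z ≡ n * (p * x)
    z≡′ = trans z≡ (trans (cong (_* x) (*-comm p n)) (*-assoc n p x))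
    z>0 : 0 < z
    z>0 = subst (0 <_) (sym z≡′) (*-pos n>0 px>0)
    px∣z : p * x ∣ z
    px∣z = subst (p * x ∣_) (sym z≡′) (n∣m*n n)
    lt : exponent p x < exponent p t
    lt = ≤-trans (≤-reflexive (sym (exponent-*-self pr x>0)))
           (≤-trans (∣⇒exponent≤ pr z>0 px∣z) (le p pr (m∣m*n n)))
    x≤t : x ≤ t
    x≤t = ≤-trans (∣⇒≤ {{>-nonZero z>0}} (∣-trans (n∣m*n p) px∣z)) (start≤ γ adm)

-- The path H → H / r ⇝ s * (Q * g) → Q * g ⇝ C * g; its capacity is decided at H / r and at Q * g.
attaining-geodesic : ∀ {H t r s g C Q} → H ≡ r * (s * g) → t ≡ C * g →
  Prime r → Prime s → 0 < g → 0 < C → ¬ s ∣ C → Q ∣ C → Q * s ≤ C →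
  H ≤ t → exponent r t < exponent r H →
  Σ[ γ ∈ Geodesic t H ] Admissible γ
    × deletionOrder γ ≡ (r , exponent r H) ∷ (s , suc (exponent s t)) ∷ []
    × d (s * g) ⊓ d (Q * g) ≤ minDivisors γ
attaining-geodesic {r = r} {s} {g} {C} {Q} refl refl pr ps g>0 C>0 s∤C (divides K C≡KQ) Qs≤C H≤t lt =
  -- Built from the end: `γ₃` inserts `K = C / Q` after the second deletion, `γ₂` puts that deletion
  -- in front, and `γ₁` inserts `Q` before it.
  let γ₃ , adm₃ , order₃ , k≤₃ = prepend-insertions K K>0 Qg>0 t≡ [] (λ _ _ _ → ≤-refl)
        (≤-refl ∷ []) (m⊓n≤n _ _)
        (≤-trans (m⊓n≤n _ _) (subst (λ w → d (Q * g) ≤ d w) (sym t≡) (d-mono-* K>0 Qg>0)))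
      γ₂ = deletion s ps Qg>0 (agree λ q pq q≢s → exponent-*-≢ ps pq q≢s Qg>0)
             lt₂ (exponent-*-self ps Qg>0) ∷ γ₃
      γ₁ , adm₁ , order₁ , k≤₁ = prepend-insertions Q Q>0 sg>0 sQg≡ γ₂ below
        (sQg≤t ∷ adm₃) (m⊓n≤m _ _)
        (⊓-glb (≤-trans (m⊓n≤n (d (s * g)) _) (<⇒≤ (d-<-prime-* ps Qg>0))) k≤₃)
  in deletion r pr sg>0 (agree λ q pq q≢r → exponent-*-≢ pr pq q≢r sg>0) lt (exponent-*-self pr sg>0) ∷ γ₁
   , H≤t ∷ adm₁
   , cong (_ ∷_) (trans order₁ (cong₂ _∷_ (cong (s ,_) level) order₃))
   , ⊓-glb (≤-trans (m⊓n≤m _ _) (<⇒≤ (d-<-prime-* pr sg>0))) k≤₁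
  where
  t = C * g
  KQ>0 : 0 < K * Q
  KQ>0 = subst (0 <_) C≡KQ C>0
  K>0 : 0 < K
  K>0 = n≢0⇒n>0 λ { refl → n≮n 0 KQ>0 }
  Q>0 : 0 < Q
  Q>0 = n≢0⇒n>0 λ { refl → n≮n 0 (subst (0 <_) (*-zeroʳ K) KQ>0) }
  sg>0 = *-pos (prime-pos ps) g>0
  Qg>0 = *-pos Q>0 g>0
  t>0  = *-pos C>0 g>0
  t≡ : t ≡ K * (Q * g)
  t≡ = trans (cong (_* g) C≡KQ) (*-assoc K Q g)
  Qg∣t : Q * g ∣ t
  Qg∣t = divides K t≡
  sQg≡ : s * (Q * g) ≡ Q * (s * g)
  sQg≡ = trans (sym (*-assoc s Q g)) (trans (cong (_* g) (*-comm s Q)) (*-assoc Q s g))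
  sQg≤t : s * (Q * g) ≤ t
  sQg≤t = subst (_≤ t) (trans (*-assoc Q s g) (sym sQg≡)) (*-monoˡ-≤ g Qs≤C)
  -- As `s` does not divide `C`, its exponent in `t = C * g` is that in `g`, and `Q * g` lies
  -- between the two in divisibility. This fixes the level of the second deletion.
  s-exponent : exponent s (Q * g) ≡ exponent s t
  s-exponent = ≤-antisym (∣⇒exponent≤ ps t>0 Qg∣t)
    (≤-trans (≤-reflexive (exponent-*-∤ ps C>0 g>0 s∤C)) (∣⇒exponent≤ ps Qg>0 (n∣m*n Q)))
  level : exponent s (s * (Q * g)) ≡ suc (exponent s t)
  level = trans (exponent-*-self ps Qg>0) (cong suc s-exponent)
  lt₂ : exponent s t < exponent s (s * (Q * g))
  lt₂ = ≤-reflexive (sym level)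
  -- A prime factor of `Q` divides `C` and so differs from `s`; the extra factor `s` then leaves its
  -- exponent within that of `t`.
  below : ∀ q → Prime q → q ∣ Q → exponent q (s * (Q * g)) ≤ exponent q t
  below q pq q∣Q = ≤-trans
    (≤-reflexive (exponent-*-≢ ps pq (λ { refl → s∤C (∣-trans q∣Q (divides K C≡KQ)) }) Qg>0))
    (∣⇒exponent≤ pq t>0 Qg∣t)

-- Deletion orders

-- The number of deletions of `q` still due on the way from `x` to `t`. At `x = H` these are the
-- summands of `L₋ H t`.
excess : ℕ → ℕ → ℕ → ℕ
excess t q x = exponent q x ∸ exponent q t

m∸n≡suc⇒ : ∀ m n {k} → m ∸ n ≡ suc k → m ≡ suc k + n
m∸n≡suc⇒ m n {k} eq = trans (sym (m∸n+n≡m {m} {n} (<⇒≤ (m∸n≢0⇒n<m λ eq0 → 0≢1+n (trans (sym eq0) eq)))))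
  (cong (_+ n) eq)

-- At `p` both excesses vanish: an insertion starts below the target exponent and does not overshoot
-- it.
insertion-excess : ∀ t {p x y} → ExponentsAgreeExceptAt p x y →
  exponent p x < exponent p t → exponent p y ≡ suc (exponent p x) →
  ∀ q → Prime q → excess t q y ≡ excess t q x
insertion-excess t {p} (agree elsewhere) lt at-p q pq with q ≟ p
... | yes refl = trans (m≤n⇒m∸n≡0 (≤-trans (≤-reflexive at-p) lt)) (sym (m≤n⇒m∸n≡0 (<⇒≤ lt)))
... | no q≢p   = cong (_∸ exponent q t) (sym (elsewhere q pq q≢p))

deletion-excess-self : ∀ t p x y → exponent p t < exponent p x → exponent p x ≡ suc (exponent p y) →
  excess t p x ≡ suc (excess t p y)
deletion-excess-self t p x y lt at-p = trans (cong (_∸ exponent p t) at-p)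
  (+-∸-assoc 1 (s≤s⁻¹ (≤-trans lt (≤-reflexive at-p))))

deletion-excess-≢ : ∀ t {p x y} → ExponentsAgreeExceptAt p x y →
  ∀ q → Prime q → q ≢ p → excess t q y ≡ excess t q x
deletion-excess-≢ t (agree elsewhere) q pq q≢p = cong (_∸ exponent q t) (sym (elsewhere q pq q≢p))

no-excess⇒order : ∀ {t x} (γ : Geodesic t x) → (∀ q → Prime q → excess t q x ≡ 0) →
  deletionOrder γ ≡ []
no-excess⇒order [] _ = refl
no-excess⇒order {t} (insertion _ _ _ ag lt at-p ∷ γ) ex =
  no-excess⇒order γ λ q pq → trans (insertion-excess t ag lt at-p q pq) (ex q pq)
no-excess⇒order {t} {x} (_∷_ {y = y} (deletion p pr _ _ lt at-p) _) ex =
  contradiction (trans (sym (ex p pr)) (deletion-excess-self t p x y lt at-p)) 0≢1+n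

-- The excesses leave room for one deletion only, of `s`; an excess of 1 means that it starts one
-- above the target exponent, which fixes the level.
single-excess⇒order : ∀ {t x s} → Prime s → (γ : Geodesic t x) → excess t s x ≡ 1 →
  (∀ q → Prime q → q ≢ s → excess t q x ≡ 0) →
  deletionOrder γ ≡ (s , suc (exponent s t)) ∷ []
single-excess⇒order {t} {s = s} ps [] ex₁ ex =
  contradiction (trans (sym (n∸n≡0 (exponent s t))) ex₁) 0≢1+n
single-excess⇒order {t} ps (insertion _ _ _ ag lt at-p ∷ γ) ex₁ ex =
  single-excess⇒order ps γ (trans (insertion-excess t ag lt at-p _ ps) ex₁)
    λ q pq q≢s → trans (insertion-excess t ag lt at-p q pq) (ex q pq q≢s)
single-excess⇒order {t} {x} {s} ps (_∷_ {y = y} (deletion p pr _ ag lt at-p) γ) ex₁ ex with p ≟ s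
... | no p≢s   = contradiction (trans (sym (ex p pr p≢s)) (deletion-excess-self t p x y lt at-p)) 0≢1+n
... | yes refl = cong₂ _∷_ (cong (p ,_) (m∸n≡suc⇒ (exponent p x) (exponent p t) ex₁))
                   (no-excess⇒order γ ex′)
  where
  ex′ : ∀ q → Prime q → excess t q y ≡ 0
  ex′ q pq with q ≟ p
  ... | yes refl = suc-injective (trans (sym (deletion-excess-self t p x y lt at-p)) ex₁)
  ... | no q≢p   = trans (deletion-excess-≢ t ag q pq q≢p) (ex q pq q≢p)

-- Only `r` and `s` have deletions due, so the first deletion is of one of them; the other then
-- carries the only excess left, and `single-excess⇒order` applies.
double-excess⇒order : ∀ {t x r s} → Prime r → Prime s → r ≢ s → (γ : Geodesic t x) →
  excess t r x ≡ 1 → excess t s x ≡ 1 →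
  (∀ q → Prime q → q ≢ r → q ≢ s → excess t q x ≡ 0) →
    deletionOrder γ ≡ (r , suc (exponent r t)) ∷ (s , suc (exponent s t)) ∷ []
  ⊎ deletionOrder γ ≡ (s , suc (exponent s t)) ∷ (r , suc (exponent r t)) ∷ []
double-excess⇒order {t} {r = r} pr ps r≢s [] exr exs ex =
  contradiction (trans (sym (n∸n≡0 (exponent r t))) exr) 0≢1+n
double-excess⇒order {t} pr ps r≢s (insertion _ _ _ ag lt at-p ∷ γ) exr exs ex =
  double-excess⇒order pr ps r≢s γ
    (trans (insertion-excess t ag lt at-p _ pr) exr) (trans (insertion-excess t ag lt at-p _ ps) exs)
    λ q pq q≢r q≢s → trans (insertion-excess t ag lt at-p q pq) (ex q pq q≢r q≢s)
double-excess⇒order {t} {x} {r} {s} pr ps r≢s (_∷_ {y = y} (deletion p pp _ ag lt at-p) γ) exr exs ex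
  with p ≟ r | p ≟ s
... | no p≢r   | no p≢s = contradiction (trans (sym (ex p pp p≢r p≢s)) (deletion-excess-self t p x y lt at-p)) 0≢1+n
... | yes refl | _      = inj₁ (cong₂ _∷_ (cong (p ,_) (m∸n≡suc⇒ (exponent p x) (exponent p t) exr))
  (single-excess⇒order ps γ (trans (deletion-excess-≢ t ag s ps (r≢s ∘ sym)) exs) ex′))
  where
  ex′ : ∀ q → Prime q → q ≢ s → excess t q y ≡ 0
  ex′ q pq q≢s with q ≟ p
  ... | yes refl = suc-injective (trans (sym (deletion-excess-self t p x y lt at-p)) exr)
  ... | no q≢p   = trans (deletion-excess-≢ t ag q pq q≢p) (ex q pq q≢p q≢s)
... | no _     | yes refl = inj₂ (cong₂ _∷_ (cong (p ,_) (m∸n≡suc⇒ (exponent p x) (exponent p t) exs))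
  (single-excess⇒order pr γ (trans (deletion-excess-≢ t ag r pr r≢s) exr) ex′))
  where
  ex′ : ∀ q → Prime q → q ≢ r → excess t q y ≡ 0
  ex′ q pq q≢r with q ≟ p
  ... | yes refl = suc-injective (trans (sym (deletion-excess-self t p x y lt at-p)) exs)
  ... | no q≢p   = trans (deletion-excess-≢ t ag q pq q≢p) (ex q pq q≢r q≢p)

-- Finite sums and maxima

-- `ys` is `xs` with one occurrence of `x` removed. Tracking the surviving members lets the
-- extraction be repeated.
sum-extract : ∀ (f : ℕ → ℕ) {x} xs → x ∈ xs →
  ∃[ ys ] sum (map f xs) ≡ f x + sum (map f ys) × (∀ {y} → y ∈ xs → y ≢ x → y ∈ ys)
sum-extract f {x} (x ∷ xs) (here refl) = xs , refl , rest
  where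
  rest : ∀ {y} → y ∈ x ∷ xs → y ≢ x → y ∈ xs
  rest (here refl) y≢x = contradiction refl y≢x
  rest (there y∈)  _   = y∈
sum-extract f {x} (w ∷ xs) (there x∈) with sum-extract f xs x∈
... | ys , eq , keep = w ∷ ys , eq′ , rest
  where
  eq′ : f w + sum (map f xs) ≡ f x + (f w + sum (map f ys))
  eq′ = trans (cong (f w +_) eq) (trans (sym (+-assoc (f w) (f x) _))
          (trans (cong (_+ sum (map f ys)) (+-comm (f w) (f x))) (+-assoc (f x) (f w) _)))
  rest : ∀ {y} → y ∈ w ∷ xs → y ≢ x → y ∈ w ∷ ys
  rest (here refl) _   = here refl
  rest (there y∈)  y≢x = there (keep y∈ y≢x)

-- A linear search; the given witness `a` is its starting value and need not lie below `n`.
argmax : ∀ {P : ℕ → Set} → Decidable P → (f : ℕ → ℕ) → ∃[ a ] P a → ∀ n →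
  ∃[ b ] P b × (∀ c → c < n → P c → f c ≤ f b)
argmax P? f (a , Pa) zero = a , Pa , λ _ ()
argmax {P} P? f a (suc n) with argmax P? f a n | P? n
... | b , Pb , max | no ¬Pn = b , Pb , max′
  where
  max′ : ∀ c → c < suc n → P c → f c ≤ f b
  max′ c c<1+n Pc with m≤n⇒m<n∨m≡n (s≤s⁻¹ c<1+n)
  ... | inj₁ c<n  = max c c<n Pc
  ... | inj₂ refl = contradiction Pc ¬Pn
... | b , Pb , max | yes Pn with ≤-total (f b) (f n)
...   | inj₁ fb≤fn = n , Pn , max′
  where
  max′ : ∀ c → c < suc n → P c → f c ≤ f n
  max′ c c<1+n Pc with m≤n⇒m<n∨m≡n (s≤s⁻¹ c<1+n)
  ... | inj₁ c<n  = ≤-trans (max c c<n Pc) fb≤fn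
  ... | inj₂ refl = ≤-refl
...   | inj₂ fn≤fb = b , Pb , max′
  where
  max′ : ∀ c → c < suc n → P c → f c ≤ f b
  max′ c c<1+n Pc with m≤n⇒m<n∨m≡n (s≤s⁻¹ c<1+n)
  ... | inj₁ c<n  = max c c<n Pc
  ... | inj₂ refl = fn≤fb

-- Fractions

-- `ℚ./` reduces to lowest terms, so the comparison is made between unreduced fractions. Once the
-- denominator is a successor, the quotient is `fromℚᵘ` of such a fraction by definition.
/-monoˡ : ∀ {a b} n .{{_ : NonZero n}} → a ≤ b → (ℤ.+ a ℚ./ n) ℚ.≤ (ℤ.+ b ℚ./ n)
/-monoˡ {a} {b} (suc n) a≤b = ℚ.toℚᵘ-cancel-≤
  (ℚᵘ.≤-respˡ-≃ (ℚᵘ.≃-sym (ℚ.toℚᵘ-fromℚᵘ (ℚᵘ.mkℚᵘ (ℤ.+ a) n)))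
  (ℚᵘ.≤-respʳ-≃ (ℚᵘ.≃-sym (ℚ.toℚᵘ-fromℚᵘ (ℚᵘ.mkℚᵘ (ℤ.+ b) n)))
  (ℚᵘ.*≤* (ℤ.*-monoʳ-≤-nonNeg (ℤ.+ suc n) (ℤ.+≤+ a≤b)))))

/-cross : ∀ a b m n .{{_ : NonZero m}} .{{_ : NonZero n}} → a * n ≡ b * m →
  (ℤ.+ a ℚ./ m) ≡ (ℤ.+ b ℚ./ n)
/-cross a b (suc m) (suc n) eq = ℚ.fromℚᵘ-cong {ℚᵘ.mkℚᵘ (ℤ.+ a) m} {ℚᵘ.mkℚᵘ (ℤ.+ b) n}
  (ℚᵘ.*≡* (trans (sym (ℤ.pos-* a (suc n))) (trans (cong ℤ.+_ eq) (ℤ.pos-* b (suc m)))))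

/-telescope : ∀ a m b .{{_ : NonZero m}} .{{_ : NonZero b}} →
  (ℤ.+ b ℚ./ m) ℚ.* (ℤ.+ a ℚ./ b) ≡ (ℤ.+ a ℚ./ m)
/-telescope a (suc m) (suc b) = ℚ.toℚᵘ-injective (begin
  ℚ.toℚᵘ (ℚ.fromℚᵘ B ℚ.* ℚ.fromℚᵘ A)               ≈⟨ ℚ.toℚᵘ-homo-* (ℚ.fromℚᵘ B) (ℚ.fromℚᵘ A) ⟩
  ℚ.toℚᵘ (ℚ.fromℚᵘ B) ℚᵘ.* ℚ.toℚᵘ (ℚ.fromℚᵘ A)     ≈⟨ ℚᵘ.*-cong (ℚ.toℚᵘ-fromℚᵘ B) (ℚ.toℚᵘ-fromℚᵘ A) ⟩
  B ℚᵘ.* A                                         ≈⟨ ℚᵘ.*≡* cross ⟩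
  ℚᵘ.mkℚᵘ (ℤ.+ a) m                                ≈⟨ ℚ.toℚᵘ-fromℚᵘ (ℚᵘ.mkℚᵘ (ℤ.+ a) m) ⟨
  ℚ.toℚᵘ (ℚ.fromℚᵘ (ℚᵘ.mkℚᵘ (ℤ.+ a) m))            ∎)
  where
  open ℚᵘ.≃-Reasoning
  A = ℚᵘ.mkℚᵘ (ℤ.+ a) b
  B = ℚᵘ.mkℚᵘ (ℤ.+ suc b) m
  cross : (ℤ.+ suc b ℤ.* ℤ.+ a) ℤ.* ℤ.+ suc m ≡ ℤ.+ a ℤ.* ℤ.+ (suc m * suc b)
  cross = trans (cong (ℤ._* ℤ.+ suc m) (ℤ.*-comm (ℤ.+ suc b) (ℤ.+ a)))
    (trans (ℤ.*-assoc (ℤ.+ a) (ℤ.+ suc b) (ℤ.+ suc m))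
    (cong (ℤ.+ a ℤ.*_) (trans (ℤ.*-comm (ℤ.+ suc b) (ℤ.+ suc m)) (sym (ℤ.pos-* (suc m) (suc b))))))

/-⊓ : ∀ a b n .{{_ : NonZero n}} → (ℤ.+ a ℚ./ n) ℚ.⊓ (ℤ.+ b ℚ./ n) ≡ (ℤ.+ (a ⊓ b) ℚ./ n)
/-⊓ a b n with ≤-total a b
... | inj₁ a≤b = trans (ℚ.p≤q⇒p⊓q≡p (/-monoˡ n a≤b)) (cong (λ c → ℤ.+ c ℚ./ n) (sym (m≤n⇒m⊓n≡m a≤b)))
... | inj₂ b≤a = trans (ℚ.p≥q⇒p⊓q≡q (/-monoˡ n b≤a)) (cong (λ c → ℤ.+ c ℚ./ n) (sym (m≥n⇒m⊓n≡n b≤a)))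

-- The two required deletions

-- A prime with positive excess divides `H`, so it is at most `H` and falls within the range of the
-- sum `L₋`.
excess>0⇒∈ : ∀ {H} t q → Prime q → 0 < H → 0 < excess t q H → q ∈ filter prime? (upTo (suc H))
excess>0⇒∈ {H} t q pq H>0 ex>0 = ∈-filter⁺ prime?
  (∈-upTo⁺ (s≤s (∣⇒≤ {{>-nonZero H>0}} (exponent>0⇒∣ q H
    (≤-trans ex>0 (m∸n≤m (exponent q H) (exponent q t))))))) pq

sum≡0⇒ : ∀ (f : ℕ → ℕ) {x} xs → x ∈ xs → sum (map f xs) ≡ 0 → f x ≡ 0
sum≡0⇒ f {x} xs x∈ eq with sum-extract f xs x∈
... | _ , eq′ , _ = m+n≡0⇒m≡0 (f x) (trans (sym eq′) eq)

a+b+c≡2 : ∀ a b c → 0 < a → 0 < b → a + (b + c) ≡ 2 → a ≡ 1 × b ≡ 1 × c ≡ 0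
a+b+c≡2 1             1             zero _ _ _  = refl , refl , refl
a+b+c≡2 (suc (suc a)) (suc b)       c    _ _ eq =
  contradiction (suc-injective (suc-injective eq)) (m+1+n≢0 a)

-- Two positive summands of a total of 2 are both 1 and exhaust it; any other prime with positive
-- excess would survive in `zs`, whose sum is 0.
excess-split : ∀ {H t r s} → 0 < H → L₋ H t ≡ 2 → Prime r → Prime s → r ≢ s →
  0 < excess t r H → 0 < excess t s H →
  excess t r H ≡ 1 × excess t s H ≡ 1 ×
  (∀ q → Prime q → q ≢ r → q ≢ s → excess t q H ≡ 0)
excess-split {H} {t} {r} {s} H>0 L≡2 pr ps r≢s exr>0 exs>0 =
  let ys , eq , keep          = sum-extract f _ (excess>0⇒∈ t r pr H>0 exr>0)
      zs , eq′ , keep′        = sum-extract f ys (keep (excess>0⇒∈ t s ps H>0 exs>0) (r≢s ∘ sym))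
      exr , exs , sum-zs≡0    = a+b+c≡2 (f r) (f s) (sum (map f zs)) exr>0 exs>0
                                  (trans (cong (f r +_) (sym eq′)) (trans (sym eq) L≡2))
  in exr , exs , λ q pq q≢r q≢s → n≤0⇒n≡0 (≮⇒≥ λ ex>0 → <⇒≢ ex>0
       (sym (sum≡0⇒ f zs (keep′ (keep (excess>0⇒∈ t q pq H>0 ex>0) q≢r) q≢s) sum-zs≡0)))
  where
  f : ℕ → ℕ
  f q = excess t q H

excess-repeated : ∀ {H t r} → 0 < H → L₋ H t ≡ 2 → Prime r → 2 ≤ excess t r H →
  excess t r H ≡ 2 × (∀ q → Prime q → q ≢ r → excess t q H ≡ 0)
excess-repeated {H} {t} {r} H>0 L≡2 pr ex≥2
  with sum-extract (λ q → excess t q H) _ (excess>0⇒∈ t r pr H>0 (≤-trans (s≤s z≤n) ex≥2))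
... | ys , eq , keep = exr , others
  where
  total : excess t r H + sum (map (λ q → excess t q H) ys) ≡ 2
  total = trans (sym eq) L≡2
  exr : excess t r H ≡ 2
  exr = ≤-antisym (m+n≤o⇒m≤o _ (≤-reflexive total)) ex≥2
  rest : sum (map (λ q → excess t q H) ys) ≡ 0
  rest = +-cancelˡ-≡ 2 _ 0 (trans (cong (_+ sum (map (λ q → excess t q H) ys)) (sym exr)) total)
  others : ∀ q → Prime q → q ≢ r → excess t q H ≡ 0
  others q pq q≢r = n≤0⇒n≡0 (≮⇒≥ λ ex>0 → <⇒≢ ex>0
    (sym (sum≡0⇒ (λ q → excess t q H) ys (keep (excess>0⇒∈ t q pq H>0 ex>0) q≢r) rest)))

-- The exponent in the gcd is the minimum of the two, and `max(a - b, 0) + min(a, b) = a`. Thus the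
-- excesses are the exponents of `H / gcd H t`.
exponent-gcd : ∀ {H t} q → Prime q → 0 < H → 0 < t → 0 < gcd H t →
  exponent q H ≡ excess t q H + exponent q (gcd H t)
exponent-gcd {H} {t} q pq H>0 t>0 g>0 = begin
  exponent q H                                   ≡⟨ m⊓n+n∸m≡n (exponent q t) (exponent q H) ⟨
  exponent q t ⊓ exponent q H + excess t q H     ≡⟨ cong (_+ excess t q H) g≡ ⟨
  exponent q (gcd H t) + excess t q H            ≡⟨ +-comm (exponent q (gcd H t)) _ ⟩
  excess t q H + exponent q (gcd H t)            ∎
  where
  open ≡-Reasoning
  g≡ : exponent q (gcd H t) ≡ exponent q t ⊓ exponent q H
  g≡ = ≤-antisym
    (⊓-glb (∣⇒exponent≤ pq t>0 (gcd[m,n]∣n H t)) (∣⇒exponent≤ pq H>0 (gcd[m,n]∣m H t)))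
    (^∣⇒≤exponent pq g>0 (gcd-greatest
      (≤exponent⇒^∣ q H (m⊓n≤n (exponent q t) (exponent q H)))
      (≤exponent⇒^∣ q t (m⊓n≤m (exponent q t) (exponent q H)))))

distinct-factorisation : ∀ {H t r s} → 0 < H → 0 < t → 0 < gcd H t → Prime r → Prime s → r ≢ s →
  excess t r H ≡ 1 → excess t s H ≡ 1 →
  (∀ q → Prime q → q ≢ r → q ≢ s → excess t q H ≡ 0) → H ≡ r * (s * gcd H t)
distinct-factorisation {H} {t} {r} {s} H>0 t>0 g>0 pr ps r≢s exr exs ex =
  exponents≡⇒≡ H>0 (*-pos (prime-pos pr) sg>0) eq
  where
  g = gcd H t
  sg>0 = *-pos (prime-pos ps) g>0
  eq : ∀ q → Prime q → exponent q H ≡ exponent q (r * (s * g))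
  eq q pq with q ≟ r | q ≟ s
  ... | yes refl | _ = trans (exponent-gcd q pq H>0 t>0 g>0) (trans (cong (_+ exponent q g) exr)
          (sym (trans (exponent-*-self pr sg>0) (cong suc (exponent-*-≢ ps pr r≢s g>0)))))
  ... | no q≢r | yes refl = trans (exponent-gcd q pq H>0 t>0 g>0) (trans (cong (_+ exponent q g) exs)
          (sym (trans (exponent-*-≢ pr pq q≢r sg>0) (exponent-*-self ps g>0))))
  ... | no q≢r | no q≢s = trans (exponent-gcd q pq H>0 t>0 g>0)
          (trans (cong (_+ exponent q g) (ex q pq q≢r q≢s))
          (sym (trans (exponent-*-≢ pr pq q≢r sg>0) (exponent-*-≢ ps pq q≢s g>0))))

repeated-factorisation : ∀ {H t r} → 0 < H → 0 < t → 0 < gcd H t → Prime r →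
  excess t r H ≡ 2 → (∀ q → Prime q → q ≢ r → excess t q H ≡ 0) → H ≡ r * (r * gcd H t)
repeated-factorisation {H} {t} {r} H>0 t>0 g>0 pr exr ex =
  exponents≡⇒≡ H>0 (*-pos (prime-pos pr) rg>0) eq
  where
  g = gcd H t
  rg>0 = *-pos (prime-pos pr) g>0
  eq : ∀ q → Prime q → exponent q H ≡ exponent q (r * (r * g))
  eq q pq with q ≟ r
  ... | yes refl = trans (exponent-gcd q pq H>0 t>0 g>0) (trans (cong (_+ exponent q g) exr)
          (sym (trans (exponent-*-self pr rg>0) (cong suc (exponent-*-self pr g>0)))))
  ... | no q≢r = trans (exponent-gcd q pq H>0 t>0 g>0) (trans (cong (_+ exponent q g) (ex q pq q≢r))
          (sym (trans (exponent-*-≢ pr pq q≢r rg>0) (exponent-*-≢ pr pq q≢r g>0))))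

squeeze₁ : ∀ {a b j} → a ∸ b ≡ 1 → b < j → j ≤ a → j ≡ a × j ≡ suc b
squeeze₁ {a} {b} eq b<j j≤a with m∸n≡suc⇒ a b eq
... | refl = ≤-antisym j≤a b<j , ≤-antisym j≤a b<j

squeeze₂ : ∀ {a b j k} → a ∸ b ≡ 2 → b < k → k < j → j ≤ a → j ≡ a × k ≡ suc b
squeeze₂ {a} {b} eq b<k k<j j≤a with m∸n≡suc⇒ a b eq
... | refl = ≤-antisym j≤a (≤-trans (s≤s b<k) k<j) , ≤-antisym (s≤s⁻¹ (≤-trans k<j j≤a)) b<k

two-levels : ∀ {a b j k} → b < k → k < j → j ≤ a → 2 ≤ a ∸ b
two-levels {a} {b} b<k k<j j≤a = m+n≤o⇒m≤o∸n 2 (≤-trans (s≤s b<k) (≤-trans k<j j≤a))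

-- The optimum for one deletion order

-- The two terms are the divisor counts at `H / r = s * g` and at the vertex `g * Q` reached by the
-- second deletion. `first-deletion` bounds every geodesic by them, since `Q` is optimal, and
-- `attaining-geodesic` realises the bound.
order-capacity : ∀ {H H' r s g C Q} .{{_ : NonZero H}} .{{_ : NonZero H'}} .{{_ : NonZero g}} →
  Consecutive H H' → Prime r → Prime s → H ≡ r * (s * g) → H' ≡ C * g → 0 < C → ¬ s ∣ C →
  exponent r H' < exponent r H → Q ∣ C → Q * s ≤ C →
  (∀ P → P ∣ C → P * s ≤ C → d (g * P) ≤ d (g * Q)) →
  Isβ H H' ((r , exponent r H) ∷ (s , suc (exponent s H')) ∷ [])
      (ℚ._/_ (ℤ.+ (d (s * g) ⊓ d (g * Q))) (d H) {{d-nonZero H}})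
order-capacity {H} {H'} {r} {s} {g} {C} {Q} cons pr ps H≡ H'≡ C>0 s∤C lt Q∣C Qs≤C Q-max =
  attained , λ { _ (γ , adm , order , refl) → /-monoˡ (d H) (minDivisors≤k γ adm order) }
  where
  open Consecutive cons
  instance
    dH≢0 : NonZero (d H)
    dH≢0 = d-nonZero H
  k = d (s * g) ⊓ d (g * Q)
  σ = (r , exponent r H) ∷ (s , suc (exponent s H')) ∷ []
  H∤H' : ¬ H ∣ H'
  H∤H' H∣H' = <⇒≱ lt (∣⇒exponent≤ pr (>-nonZero⁻¹ H') H∣H')
  g∣H : g ∣ H
  g∣H = subst (g ∣_) (sym H≡) (∣n⇒∣m*n r (n∣m*n s))

  minDivisors≤k : (γ : Geodesic H' H) → Admissible γ → deletionOrder γ ≡ σ → minDivisors γ ≤ k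
  minDivisors≤k γ adm order
    with first-deletion γ (>-nonZero⁻¹ H') (>-nonZero⁻¹ H) H∤H' (consecutive⇒d≤ cons)
           (divides C H'≡) g∣H adm order
  -- The vertex after the second deletion is `z = P * g`; cancelling `g` turns `z ∣ H'` and
  -- `s * z ≤ H'` into the two conditions on `P`.
  ... | y , z , H≡ry , min≤dy , divides P z≡ , z∣H' , sz≤H' , min≤dz = ⊓-glb
      (subst (λ w → minDivisors γ ≤ d w)
        (*-cancelˡ-≡ y (s * g) r {{prime⇒nonZero pr}} (trans (sym H≡ry) H≡)) min≤dy)
      (≤-trans (subst (λ w → minDivisors γ ≤ d w) (trans z≡ (*-comm P g)) min≤dz)
        (Q-max P (*-cancelʳ-∣ g (subst₂ _∣_ z≡ H'≡ z∣H'))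
          (*-cancelʳ-≤ (P * s) C g (subst₂ _≤_ sz≡ H'≡ sz≤H'))))
    where
    sz≡ : s * z ≡ P * s * g
    sz≡ = trans (cong (s *_) z≡) (trans (sym (*-assoc s P g)) (cong (_* g) (*-comm s P)))

  attained : Σ[ γ ∈ Geodesic H' H ] Admissible γ × deletionOrder γ ≡ σ
               × (ℤ.+ k) ℚ./ d H ≡ capacity γ
  attained =
    let γ , adm , order , k≤ = attaining-geodesic H≡ H'≡ pr ps (>-nonZero⁻¹ g) C>0 s∤C Q∣C Qs≤C
                                 (<⇒≤ ordered) lt
    in γ , adm , order , cong (λ m → (ℤ.+ m) ℚ./ d H) (≤-antisym
         (subst (λ w → d (s * g) ⊓ d w ≤ minDivisors γ) (*-comm Q g) k≤)
         (minDivisors≤k γ adm order))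

-- Here `y` is `H / r` and `a` stands for the maximal `d (g * Q)`. By `d-prime-*` the first term is
-- `d y / d H`; in the second, `d g` cancels and `a / d H` remains.
capacity-formula : ∀ {H r y g a} .{{_ : NonZero (d H)}} .{{_ : NonZero (d g)}} →
  Prime r → 0 < y → H ≡ r * y →
  α (exponent r H) ℚ.⊓ (((ℤ.+ d g) ℚ./ d H) ℚ.* ((ℤ.+ a) ℚ./ d g)) ≡ (ℤ.+ (d y ⊓ a)) ℚ./ d H
capacity-formula {H} {r} {y} {g} {a} pr y>0 H≡ =
  trans (cong₂ ℚ._⊓_ α≡ (/-telescope a (d H) (d g))) (/-⊓ (d y) a (d H))
  where
  open ≡-Reasoning
  j≡ : exponent r H ≡ suc (exponent r y)
  j≡ = trans (cong (exponent r) H≡) (exponent-*-self pr y>0)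
  α≡ : α (exponent r H) ≡ (ℤ.+ d y) ℚ./ d H
  α≡ = /-cross (exponent r H) (d y) (suc (exponent r H)) (d H) (begin
    exponent r H * d H                   ≡⟨ cong₂ _*_ j≡ (cong d H≡) ⟩
    suc (exponent r y) * d (r * y)       ≡⟨ d-prime-* pr y>0 ⟨
    d y * suc (suc (exponent r y))       ≡⟨ cong (λ j → d y * suc j) j≡ ⟨
    d y * suc (exponent r H)             ∎)

order-optimum : ∀ {H H' r s} .{{_ : NonZero H}} .{{_ : NonZero H'}} → Consecutive H H' →
  Prime r → Prime s → H ≡ r * (s * gcd H H') → exponent r H' < exponent r H →
  let instance
        g≢0 : NonZero (gcd H H')
        g≢0 = gcd-nonZero H H'
      g = gcd H H'
  in Σ[ R ∈ ℚ.ℚ ] IsR s (H' / g) g R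
       × Isβ H H' ((r , exponent r H) ∷ (s , suc (exponent s H')) ∷ [])
               (α (exponent r H) ℚ.⊓ (δ H H' ℚ.* R))
order-optimum {H} {H'} {r} {s} cons pr ps H≡ lt =
  -- `Q = 1` starts the search, being feasible by `s≤C`; the bound `suc C` covers every divisor of
  -- `C`.
  let Q , (Q∣C , Qs≤C) , max = argmax (λ Q → (Q ∣? C) ×-dec (Q * s ≤? C)) (λ Q → d (g * Q))
                                 (1 , 1∣ C , s≤C) (suc C)
      Q-max : ∀ P → P ∣ C → P * s ≤ C → d (g * P) ≤ d (g * Q)
      Q-max P P∣C Ps≤C = max P (s≤s (∣⇒≤ {{>-nonZero C>0}} P∣C)) (P∣C , Ps≤C)
  in (ℤ.+ d (g * Q)) ℚ./ d g
   , ((Q , Q∣C , Qs≤C , refl) , λ { _ (P , P∣C , Ps≤C , refl) → /-monoˡ (d g) (Q-max P P∣C Ps≤C) })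
   , subst (Isβ H H' _) (sym (capacity-formula {H} {r} {s * g} {g} {d (g * Q)} pr sg>0 H≡))
       (order-capacity cons pr ps H≡ H'≡ C>0 s∤C lt Q∣C Qs≤C Q-max)
  where
  open Consecutive cons
  g = gcd H H'
  instance
    g≢0 : NonZero g
    g≢0 = gcd-nonZero H H'
    dH≢0 : NonZero (d H)
    dH≢0 = d-nonZero H
    dg≢0 : NonZero (d g)
    dg≢0 = d-nonZero g
  C = H' / g
  sg>0 : 0 < s * g
  sg>0 = *-pos (prime-pos ps) (>-nonZero⁻¹ g)
  H'≡ : H' ≡ C * g
  H'≡ = sym (m/n*n≡m (gcd[m,n]∣n H H'))
  C>0 : 0 < C
  C>0 = n≢0⇒n>0 λ C≡0 → <⇒≢ (>-nonZero⁻¹ H') (sym (trans H'≡ (cong (_* g) C≡0)))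
  -- Otherwise `s * g` would be a common divisor of `H` and `H'` larger than `g`.
  s∤C : ¬ s ∣ C
  s∤C s∣C = <⇒≱ (subst (g <_) (*-comm g s) (m<m*n g s (prime>1 ps)))
    (∣⇒≤ (gcd-greatest (subst (s * g ∣_) (sym H≡) (n∣m*n r))
                       (subst (s * g ∣_) (sym H'≡) (*-monoˡ-∣ g s∣C))))
  -- Cancel `g` in `s * g ≤ H < H' = C * g`.
  s≤C : 1 * s ≤ C
  s≤C = *-cancelʳ-≤ (1 * s) C g (subst₂ _≤_ (cong (_* g) (sym (*-identityˡ s))) H'≡
    (≤-trans (subst (s * g ≤_) (sym H≡) (m≤n*m (s * g) r {{prime⇒nonZero pr}})) (<⇒≤ ordered)))

-- Combining the two deletion orders

geo-optimum : ∀ {H H' σ τ} .{{_ : NonZero H}} →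
  ((γ : Geodesic H' H) → deletionOrder γ ≡ σ ⊎ deletionOrder γ ≡ τ) →
  ∀ β₁ β₂ → Isβ H H' σ β₁ → Isβ H H' τ β₂ → Isβgeo H H' (β₁ ℚ.⊔ β₂)
geo-optimum {H} {H'} orders β₁ β₂ ((γ₁ , adm₁ , _ , β₁≡) , max₁) ((γ₂ , adm₂ , _ , β₂≡) , max₂) =
  attained , upper
  where
  attained : Σ[ γ ∈ Geodesic H' H ] Admissible γ × β₁ ℚ.⊔ β₂ ≡ capacity γ
  -- The larger of `β₁` and `β₂` equals one of them, and a geodesic attaining that one serves.
  attained = [ (λ eq → γ₁ , adm₁ , trans eq β₁≡) , (λ eq → γ₂ , adm₂ , trans eq β₂≡) ]′ (ℚ.⊔-sel β₁ β₂)
  upper : ∀ x → Σ[ γ ∈ Geodesic H' H ] Admissible γ × x ≡ capacity γ → x ℚ.≤ β₁ ℚ.⊔ β₂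
  upper x (γ , adm , x≡) =
    [ (λ order → ℚ.≤-trans (max₁ x (γ , adm , order , x≡)) (ℚ.p≤p⊔q β₁ β₂))
    , (λ order → ℚ.≤-trans (max₂ x (γ , adm , order , x≡)) (ℚ.p≤q⊔p β₁ β₂)) ]′ (orders γ)

pair-admissible : ∀ {r s jr js} → (r ≡ s → js < jr) → AdmissibleOrder ((r , jr) ∷ (s , js) ∷ [])
pair-admissible lt = (lt ∷ []) ∷ [] ∷ []

theorem5p4 : (H H' : ℕ) .{{_ : NonZero H}} .{{_ : NonZero H'}} →
    Consecutive H H' → L₋ H H' ≡ 2 →
    (r s jr js : ℕ) →
    RequiredDeletion H H' (r , jr) → RequiredDeletion H H' (s , js) → (r , jr) ≢ (s , js) →
    let instance
          g≢0 : NonZero (gcd H H')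
          g≢0 = gcd-nonZero H H'
        g   = gcd H H'
        C   = H' / g
        r∣s = (r , jr) ∷ (s , js) ∷ []
        s∣r = (s , js) ∷ (r , jr) ∷ []
    in
      (H / g ≡ r * s)
    × (AdmissibleOrder r∣s →
         Σ[ R ∈ ℚ.ℚ ] IsR s C g R × Isβ H H' r∣s (α jr ℚ.⊓ (δ H H' ℚ.* R)))
    × (r ≢ s →
         AdmissibleOrder r∣s × AdmissibleOrder s∣r
         × (∀ βrs βsr → Isβ H H' r∣s βrs → Isβ H H' s∣r βsr → Isβgeo H H' (βrs ℚ.⊔ βsr)))
    × (r ≡ s →
         (jr ≡ exponent r H × AdmissibleOrder r∣s × ¬ AdmissibleOrder s∣r)
         ⊎ (js ≡ exponent s H × AdmissibleOrder s∣r × ¬ AdmissibleOrder r∣s))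
theorem5p4 H H' cons L≡2 r s jr js (pr , br<jr , jr≤ar) (ps , bs<js , js≤as) distinct =
  cofactor , optimum , distinct-primes , repeated-prime
  where
  g = gcd H H'
  instance
    g≢0 : NonZero g
    g≢0 = gcd-nonZero H H'
  g>0 : 0 < g
  g>0 = >-nonZero⁻¹ g
  H>0 : 0 < H
  H>0 = >-nonZero⁻¹ H
  H'>0 : 0 < H'
  H'>0 = >-nonZero⁻¹ H'
  r∣s = (r , jr) ∷ (s , js) ∷ []
  s∣r = (s , js) ∷ (r , jr) ∷ []

  split : r ≢ s → excess H' r H ≡ 1 × excess H' s H ≡ 1 ×
                  (∀ q → Prime q → q ≢ r → q ≢ s → excess H' q H ≡ 0)
  split r≢s = excess-split {t = H'} H>0 L≡2 pr ps r≢s (m<n⇒0<n∸m (<-≤-trans br<jr jr≤ar))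
                                            (m<n⇒0<n∸m (<-≤-trans bs<js js≤as))

  repeated : r ≡ s → excess H' r H ≡ 2 × (∀ q → Prime q → q ≢ r → excess H' q H ≡ 0)
  repeated refl = excess-repeated {t = H'} H>0 L≡2 pr levels
    where
    levels : 2 ≤ excess H' r H
    levels with <-cmp jr js
    ... | tri< jr<js _ _ = two-levels br<jr jr<js js≤as
    ... | tri≈ _ refl _  = contradiction refl distinct
    ... | tri> _ _ js<jr = two-levels bs<js js<jr jr≤ar

  H≡ : H ≡ r * (s * g)
  H≡ with r ≟ s
  ... | no r≢s   = let exr , exs , ex = split r≢s
                   in distinct-factorisation H>0 H'>0 g>0 pr ps r≢s exr exs ex
  ... | yes refl = let exr , ex = repeated refl in repeated-factorisation H>0 H'>0 g>0 pr exr ex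

  cofactor : H / g ≡ r * s
  cofactor = trans (/-congˡ {o = g} (trans H≡ (sym (*-assoc r s g)))) (m*n/n≡m (r * s) g)

  -- Admissibility makes the first level the top one and the second the lowest above the exponent in
  -- `H'`, the form in which `order-optimum` states the order.
  levels : AdmissibleOrder r∣s → jr ≡ exponent r H × js ≡ suc (exponent s H')
  levels ((js<jr ∷ []) ∷ _) with r ≟ s
  ... | no r≢s   = let exr , exs , _ = split r≢s
                   in proj₁ (squeeze₁ exr br<jr jr≤ar) , proj₂ (squeeze₁ exs bs<js js≤as)
  ... | yes refl = squeeze₂ (proj₁ (repeated refl)) bs<js (js<jr refl) jr≤ar

  optimum : AdmissibleOrder r∣s →
    Σ[ R ∈ ℚ.ℚ ] IsR s (H' / g) g R × Isβ H H' r∣s (α jr ℚ.⊓ (δ H H' ℚ.* R))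
  optimum adm = subst₂
    (λ j k → Σ[ R ∈ ℚ.ℚ ] IsR s (H' / g) g R
               × Isβ H H' ((r , j) ∷ (s , k) ∷ []) (α j ℚ.⊓ (δ H H' ℚ.* R)))
    (sym (proj₁ (levels adm))) (sym (proj₂ (levels adm)))
    (order-optimum cons pr ps H≡ (<-≤-trans br<jr jr≤ar))

  distinct-primes : r ≢ s → AdmissibleOrder r∣s × AdmissibleOrder s∣r
    × (∀ βrs βsr → Isβ H H' r∣s βrs → Isβ H H' s∣r βsr → Isβgeo H H' (βrs ℚ.⊔ βsr))
  distinct-primes r≢s =
      pair-admissible (λ r≡s → contradiction r≡s r≢s)
    , pair-admissible (λ s≡r → contradiction (sym s≡r) r≢s)
    , geo-optimum orders
    where
    orders : (γ : Geodesic H' H) → deletionOrder γ ≡ r∣s ⊎ deletionOrder γ ≡ s∣r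
    orders γ =
      let exr , exs , ex = split r≢s
      -- `double-excess⇒order` gives the levels as one more than the exponents in `H'`, which for
      -- excess 1 are `jr` and `js`.
      in subst₂ (λ j k → deletionOrder γ ≡ (r , j) ∷ (s , k) ∷ [] ⊎ deletionOrder γ ≡ (s , k) ∷ (r , j) ∷ [])
           (sym (proj₂ (squeeze₁ exr br<jr jr≤ar))) (sym (proj₂ (squeeze₁ exs bs<js js≤as)))
           (double-excess⇒order pr ps r≢s γ exr exs ex)

  repeated-prime : r ≡ s →
      (jr ≡ exponent r H × AdmissibleOrder r∣s × ¬ AdmissibleOrder s∣r)
    ⊎ (js ≡ exponent s H × AdmissibleOrder s∣r × ¬ AdmissibleOrder r∣s)
  repeated-prime refl with <-cmp jr js
  -- Distinct layers of one prime have distinct levels, and only the order starting from the higher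
  -- one satisfies the constraint.
  ... | tri≈ _ refl _  = contradiction refl distinct
  ... | tri> _ _ js<jr = inj₁
    ( proj₁ (squeeze₂ (proj₁ (repeated refl)) bs<js js<jr jr≤ar) , pair-admissible (λ _ → js<jr)
    , λ { ((jr<js ∷ []) ∷ _) → <-asym js<jr (jr<js refl) })
  ... | tri< jr<js _ _ = inj₂
    ( proj₁ (squeeze₂ (proj₁ (repeated refl)) br<jr jr<js js≤as) , pair-admissible (λ _ → jr<js)
    , λ { ((js<jr ∷ []) ∷ _) → <-asym jr<js (js<jr refl) })
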